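{- Every pair of $k$-stars whose union is $(k+1)$-crossing-free have a unique common bisector.
   Context: Points are vertices of a convex $n$-gon on the unit circle labelled counterclockwise by $\mathbb{Z}_n$ ($n\ge 2k+1$); $u\prec v\prec w$ denotes counterclockwise cyclic order. Two edges cross if their open segments intersect; an $\ell$-crossing is a set of $\ell$ mutually crossing edges. A $k$-star is a set of edges $\{[s_j,s_{j+k}]: j\in\mathbb{Z}_{2k+1}\}$ with $s_0\prec s_1\prec\dots\prec s_{2k}\prec s_0$. An angle $\angle(u,v,w)$ of an edge set $E$ is a pair $\{[u,v],[v,w]\}\subseteq E$ with $u\prec v\prec w$ such that no edge $[v,t]$ with $w\prec t\prec u$ belongs to $E$; for such $t$ the edge $[v,t]$ is a bisector of the angle. A bisector of a $k$-star $S$ is a bisector of an angle of $S$ (viewed as an edge set). A common bisector of two $k$-stars is an edge that is a bisector of both. -}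

module Defs where

open import Data.Nat using (ℕ; zero; suc; _+_; _<_; _≤_)
open import Data.Nat.DivMod using (_mod_)
open import Data.Fin using (Fin; toℕ)
open import Data.Product using (Σ; _×_; ∃; ∃-syntax; _,_)
open import Data.Sum using (_⊎_)
open import Relation.Nullary using (¬_)
open import Relation.Binary.PropositionalEquality using (_≡_; _≢_)

-- Vertices of the convex n-gon: Fin n (= ℤ_n), labelled counterclockwise.
-- Strict counterclockwise cyclic order  a ≺ b ≺ c  (implies a, b, c distinct).
Cyc : ∀ {n} → Fin n → Fin n → Fin n → Set
Cyc a b c =
  (toℕ a < toℕ b × toℕ b < toℕ c) ⊎
  ((toℕ b < toℕ c × toℕ c < toℕ a) ⊎
   (toℕ c < toℕ a × toℕ a < toℕ b))

-- An edge set: a predicate on ordered pairs; [x,y] ∈ E iff E x y or E y x.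
EdgeSet : ℕ → Set₁
EdgeSet n = Fin n → Fin n → Set

_∋[_,_] : ∀ {n} → EdgeSet n → Fin n → Fin n → Set
E ∋[ x , y ] = E x y ⊎ E y x

_∪_ : ∀ {n} → EdgeSet n → EdgeSet n → EdgeSet n
(E ∪ F) x y = E x y ⊎ F x y

SameEdge : ∀ {n} → Fin n → Fin n → Fin n → Fin n → Set
SameEdge x y x' y' = (x ≡ x' × y ≡ y') ⊎ (x ≡ y' × y ≡ x')

-- Open segments [a,b] and [c,d] of the convex polygon intersect:
-- exactly one of c, d lies on the open arc going counterclockwise from a to b,
-- and the other on the complementary open arc.
Cross : ∀ {n} → Fin n → Fin n → Fin n → Fin n → Set
Cross a b c d = (Cyc a c b × Cyc a b d) ⊎ (Cyc a d b × Cyc a b c)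

HasCrossing : ∀ {n} → ℕ → EdgeSet n → Set
HasCrossing {n} ℓ E =
  Σ (Fin ℓ → Fin n) λ p → Σ (Fin ℓ → Fin n) λ q →
    (∀ i → E ∋[ p i , q i ]) ×
    (∀ i j → i ≢ j → Cross (p i) (q i) (p j) (q j))

CrossingFree : ∀ {n} → ℕ → EdgeSet n → Set
CrossingFree ℓ E = ¬ HasCrossing ℓ E

IsStarSeq : ∀ {n} (k : ℕ) → (Fin (suc (k + k)) → Fin n) → Set
IsStarSeq k s = ∀ i j l → toℕ i < toℕ j → toℕ j < toℕ l → Cyc (s i) (s j) (s l)

shiftₖ : (k : ℕ) → Fin (suc (k + k)) → Fin (suc (k + k))
shiftₖ k j = (toℕ j + k) mod (suc (k + k))

Star : ∀ {n} (k : ℕ) → (Fin (suc (k + k)) → Fin n) → EdgeSet n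
Star k s x y = ∃[ j ] (x ≡ s j × y ≡ s (shiftₖ k j))

Angle : ∀ {n} → EdgeSet n → Fin n → Fin n → Fin n → Set
Angle E u v w =
  E ∋[ u , v ] × E ∋[ v , w ] × Cyc u v w ×
  (∀ t → Cyc w t u → ¬ (E ∋[ v , t ]))

IsBisector : ∀ {n} → EdgeSet n → Fin n → Fin n → Set
IsBisector E x y =
  ∃[ u ] ∃[ v ] ∃[ w ] (Angle E u v w ×
    ((x ≡ v × Cyc w y u) ⊎ (y ≡ v × Cyc w x u)))

SameEdgeSet : ∀ {n} → EdgeSet n → EdgeSet n → Set
SameEdgeSet E F = ∀ x y → (E ∋[ x , y ] → F ∋[ x , y ]) × (F ∋[ x , y ] → E ∋[ x , y ])

{-# OPTIONS --safe #-}
module Submission where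

-- Unroll the circle, so that the vertices of a k-star become an increasing sequence a with
-- a(i+2k+1) = a(i) + n and edges [a(i), a(i+k)]; the bisectors at a(i) are the edges to points of
-- ]a(i+k), a(i+k+1)[.  Let a and b be two such sequences.
--
-- Existence: let b(c(i)) be the last b before a(i).  The edge [a(i), b(c(i)+k+1)] is a common
-- bisector (up to coincidences of vertices) unless b(c(i)+k+1) lies before a(i+k) or after
-- a(i+k+1).  These two failures alternate along i, i+k, i+2k, …, which closes up modulo 2k+1
-- after an odd number of steps, so some i does not fail.
--
-- Crossing-freeness enters through one construction: consecutive mutually crossing chords of one
-- star, continued by consecutive chords of the other, form a (k+1)-crossing if the endpoints are
-- in the right order at the junction.  Excluding these shows that two stars sharing an angle are
-- equal, and that around a common bisector [a(0), b(k+1)] one has a(j) ≤ b(j) and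
-- b(k+1+j) ≤ a(k+j) for 1 ≤ j ≤ k; such inequalities leave no room for a second common bisector.

open import Defs
open import Data.Nat using (ℕ; zero; suc; _+_; _*_; _∸_; _≤_; _<_; z≤n; s≤s; NonZero; _/_; _%_; _<?_; _≤?_)
open import Data.Nat.Properties
open import Data.Nat.DivMod using (_mod_; m≡m%n+[m/n]*n; [m+kn]%n≡m%n; m%n<n; m<n⇒m%n≡m; m<n⇒m/n≡0; m*n/n≡m; +-distrib-/-∣ˡ)
open import Data.Nat.Divisibility using (divides-refl)
open import Data.Nat.Tactic.RingSolver using (solve-∀)
open import Data.Fin using (Fin; toℕ; fromℕ<) renaming (zero to fzero; suc to fsuc)
open import Data.Fin.Properties using (toℕ-injective; toℕ-fromℕ<; toℕ<n)
open import Data.Product using (Σ; _×_; _,_; ∃-syntax; proj₁; proj₂)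
open import Data.Sum using (_⊎_; inj₁; inj₂; swap) renaming (map to ⊎-map)
open import Data.Empty using (⊥; ⊥-elim)
open import Function using (_∘_)
open import Relation.Nullary using (¬_; yes; no)
open import Relation.Binary.Definitions using (tri<; tri≈; tri>)
open import Relation.Binary.PropositionalEquality using (_≡_; _≢_; refl; sym; trans; cong; cong₂; subst; subst₂; module ≡-Reasoning)

-- Cyclic order and increasing sequences of naturals.

+-exchange : ∀ x y z → x + (y + z) ≡ y + (x + z)
+-exchange = solve-∀

Cyc-rotate : ∀ {n} {a b c : Fin n} → Cyc a b c → Cyc b c a
Cyc-rotate (inj₁ p)        = inj₂ (inj₂ p)
Cyc-rotate (inj₂ (inj₁ p)) = inj₁ p
Cyc-rotate (inj₂ (inj₂ p)) = inj₂ (inj₁ p)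

Cyc-asym : ∀ {n} {a b c : Fin n} → Cyc a b c → ¬ Cyc a c b
Cyc-asym (inj₁ (p , q))        (inj₁ (r , s))        = <-asym q s
Cyc-asym (inj₁ (p , q))        (inj₂ (inj₁ (r , s))) = <-asym q r
Cyc-asym (inj₁ (p , q))        (inj₂ (inj₂ (r , s))) = <-asym p r
Cyc-asym (inj₂ (inj₁ (p , q))) (inj₁ (r , s))        = <-asym q r
Cyc-asym (inj₂ (inj₁ (p , q))) (inj₂ (inj₁ (r , s))) = <-asym p r
Cyc-asym (inj₂ (inj₁ (p , q))) (inj₂ (inj₂ (r , s))) = <-asym q s
Cyc-asym (inj₂ (inj₂ (p , q))) (inj₁ (r , s))        = <-asym p r
Cyc-asym (inj₂ (inj₂ (p , q))) (inj₂ (inj₁ (r , s))) = <-asym q s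
Cyc-asym (inj₂ (inj₂ (p , q))) (inj₂ (inj₂ (r , s))) = <-asym q r

Cyc-irrefl : ∀ {n} {a b : Fin n} → ¬ Cyc a b b
Cyc-irrefl c = Cyc-asym c c

module Increasing {f : ℕ → ℕ} (step : ∀ i → f i < f (suc i)) where

  mono-≤ : ∀ {i j} → i ≤ j → f i ≤ f j
  mono-≤ {i} {zero}  z≤n = ≤-refl
  mono-≤ {i} {suc j} i≤1+j with m≤n⇒m<n∨m≡n i≤1+j
  ... | inj₁ (s≤s i≤j) = ≤-trans (mono-≤ i≤j) (<⇒≤ (step j))
  ... | inj₂ refl      = ≤-refl

  mono-< : ∀ {i j} → i < j → f i < f j
  mono-< {i} i<j = <-≤-trans (step i) (mono-≤ i<j)

  cancel-< : ∀ {i j} → f i < f j → i < j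
  cancel-< fi<fj = ≰⇒> λ j≤i → <⇒≱ fi<fj (mono-≤ j≤i)

  injective : ∀ {i j} → f i ≡ f j → i ≡ j
  injective {i} {j} eq with <-cmp i j
  ... | tri< i<j _ _ = ⊥-elim (<⇒≢ (mono-< i<j) eq)
  ... | tri≈ _ i≡j _ = i≡j
  ... | tri> _ _ j<i = ⊥-elim (<⇒≢ (mono-< j<i) (sym eq))

  expanding : ∀ i → i ≤ f i
  expanding zero    = z≤n
  expanding (suc i) = ≤-<-trans (expanding i) (step i)

  -- As `v ≤ f v` by `expanding`, a downward search may start at index `v`; it stops at the last
  -- index whose value is below `v`.
  bracket : ∀ {v} → f 0 < v → ∃[ c ] (f c < v × v ≤ f (suc c))
  bracket {v} f0<v = search v (expanding v)
    where
    search : ∀ d → v ≤ f d → ∃[ c ] (f c < v × v ≤ f (suc c))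
    search zero    v≤f0 = ⊥-elim (<⇒≱ f0<v v≤f0)
    search (suc d) v≤fd with f d <? v
    ... | yes fd<v = d , fd<v , v≤fd
    ... | no  fd≮v = search d (≮⇒≥ fd≮v)

-- The circle and its universal cover.

-- A point u : ℕ of the universal cover of the n-gon projects to the vertex π u.
module Circle (n : ℕ) .{{_ : NonZero n}} where

  π : ℕ → Fin n
  π u = u mod n

  toℕ-π : ∀ u → toℕ (π u) ≡ u % n
  toℕ-π u = toℕ-fromℕ< (m%n<n u n)

  π-toℕ : ∀ (x : Fin n) → π (toℕ x) ≡ x
  π-toℕ x = toℕ-injective (trans (toℕ-π (toℕ x)) (m<n⇒m%n≡m (toℕ<n x)))

  π-+ : ∀ q u → π (q * n + u) ≡ π u
  π-+ q u = toℕ-injective (begin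
    toℕ (π (q * n + u)) ≡⟨ toℕ-π (q * n + u) ⟩
    (q * n + u) % n     ≡⟨ cong (_% n) (+-comm (q * n) u) ⟩
    (u + q * n) % n     ≡⟨ [m+kn]%n≡m%n u q n ⟩
    u % n               ≡⟨ toℕ-π u ⟨
    toℕ (π u)           ∎)
    where open ≡-Reasoning

  π-turn : ∀ u → π (n + u) ≡ π u
  π-turn u = trans (cong (λ z → π (z + u)) (sym (+-identityʳ n))) (π-+ 1 u)

  decompose : ∀ u → u ≡ toℕ (π u) + u / n * n
  decompose u = trans (m≡m%n+[m/n]*n u n) (cong (_+ u / n * n) (sym (toℕ-π u)))

  -- Turns are added on both sides because neither lift is known to be the larger; each point
  -- receives the quotient of the other.
  π-≡⇒ : ∀ {u v} → π u ≡ π v → ∃[ q ] ∃[ q' ] (q * n + u ≡ q' * n + v)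
  π-≡⇒ {u} {v} eq = v / n , u / n , (begin
    v / n * n + u                       ≡⟨ cong (v / n * n +_) (decompose u) ⟩
    v / n * n + (toℕ (π u) + u / n * n) ≡⟨ cong (λ x → v / n * n + (toℕ x + u / n * n)) eq ⟩
    v / n * n + (toℕ (π v) + u / n * n) ≡⟨ reverse (v / n * n) (toℕ (π v)) (u / n * n) ⟩
    u / n * n + (toℕ (π v) + v / n * n) ≡⟨ cong (u / n * n +_) (decompose v) ⟨
    u / n * n + v                       ∎)
    where
    open ≡-Reasoning
    reverse : ∀ x y z → x + (y + z) ≡ z + (y + x)
    reverse = solve-∀

  -- A step shorter than a turn passes at most one multiple of `n`, so the quotient grows by at most
  -- one; when it does grow, the residues come in reversed order.
  within-turn : ∀ {u v} → u < v → v < n + u →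
    (v / n ≡ u / n × toℕ (π u) < toℕ (π v)) ⊎ (v / n ≡ suc (u / n) × toℕ (π v) < toℕ (π u))
  within-turn {u} {v} u<v v<n+u with <-cmp (u / n) (v / n)
  ... | tri≈ _ eq _ = inj₁ (sym eq , +-cancelʳ-< (u / n * n) _ _
        (subst₂ _<_ (decompose u) (trans (decompose v) (cong (λ q → toℕ (π v) + q * n) (sym eq))) u<v))
  ... | tri> _ _ v/n<u/n = ⊥-elim (<-asym u<v (begin-strict
        v                            ≡⟨ decompose v ⟩
        toℕ (π v) + v / n * n        <⟨ +-monoˡ-< (v / n * n) (toℕ<n (π v)) ⟩
        suc (v / n) * n              ≤⟨ *-monoˡ-≤ n v/n<u/n ⟩
        u / n * n                    ≤⟨ m≤n+m _ (toℕ (π u)) ⟩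
        toℕ (π u) + u / n * n        ≡⟨ decompose u ⟨
        u                            ∎))
        where open ≤-Reasoning
  ... | tri< u/n<v/n _ _ with m≤n⇒m<n∨m≡n u/n<v/n
  ...   | inj₂ eq = inj₂ (sym eq , +-cancelʳ-< (suc (u / n) * n) _ _ (subst₂ _<_
            (trans (decompose v) (cong (λ q → toℕ (π v) + q * n) (sym eq)))
            (trans (cong (n +_) (decompose u)) (+-exchange n (toℕ (π u)) (u / n * n))) v<n+u))
  ...   | inj₁ 1+u/n<v/n = ⊥-elim (<-asym v<n+u (begin-strict
            n + u                           ≡⟨ cong (n +_) (decompose u) ⟩
            n + (toℕ (π u) + u / n * n)     <⟨ +-monoʳ-< n (+-monoˡ-< (u / n * n) (toℕ<n (π u))) ⟩
            suc (suc (u / n)) * n           ≤⟨ *-monoˡ-≤ n 1+u/n<v/n ⟩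
            v / n * n                       ≤⟨ m≤n+m _ (toℕ (π v)) ⟩
            toℕ (π v) + v / n * n           ≡⟨ decompose v ⟨
            v                               ∎))
          where open ≤-Reasoning

  π-distinct : ∀ {u v} → u < v → v < n + u → π u ≢ π v
  π-distinct u<v v<n+u eq with within-turn u<v v<n+u
  ... | inj₁ (_ , lt) = <⇒≢ lt (cong toℕ eq)
  ... | inj₂ (_ , lt) = <⇒≢ lt (cong toℕ (sym eq))

  π-injective-within-turn : ∀ {w u v} → w ≤ u → u < n + w → w ≤ v → v < n + w → π u ≡ π v → u ≡ v
  π-injective-within-turn {w} {u} {v} w≤u u<n+w w≤v v<n+w eq with <-cmp u v
  ... | tri≈ _ u≡v _ = u≡v
  ... | tri< u<v _ _ = ⊥-elim (π-distinct u<v (<-≤-trans v<n+w (+-monoʳ-≤ n w≤u)) eq)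
  ... | tri> _ _ v<u = ⊥-elim (π-distinct v<u (<-≤-trans u<n+w (+-monoʳ-≤ n w≤v)) (sym eq))

  -- The disjunct of `Cyc` depends on where a multiple of `n` is passed: nowhere, between `v` and
  -- `w`, or between `u` and `v`. The other combinations have inconsistent quotients.
  π-Cyc : ∀ {u v w} → u < v → v < w → w < n + u → Cyc (π u) (π v) (π w)
  π-Cyc {u} {v} {w} u<v v<w w<n+u
    with within-turn u<v (<-trans v<w w<n+u) | within-turn (<-trans u<v v<w) w<n+u
       | within-turn v<w (<-trans w<n+u (+-monoʳ-< n u<v))
  ... | inj₁ (_ , U<V) | _              | inj₁ (_ , V<W) = inj₁ (U<V , V<W)
  ... | inj₁ (_ , U<V) | inj₂ (_ , W<U) | _              = inj₂ (inj₂ (W<U , U<V))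
  ... | inj₁ (p , U<V) | inj₁ (q , _)   | inj₂ (r , _)   = ⊥-elim (m≢1+n+m _ {n = 0} (trans (sym q) (trans r (cong suc p))))
  ... | inj₂ (_ , V<U) | inj₂ (_ , W<U) | inj₁ (_ , V<W) = inj₂ (inj₁ (V<W , W<U))
  ... | inj₂ (p , V<U) | inj₁ (q , _)   | inj₁ (r , _)   = ⊥-elim (m≢1+n+m _ {n = 0} (trans (sym q) (trans r p)))
  ... | inj₂ (p , V<U) | inj₁ (q , _)   | inj₂ (r , _)   = ⊥-elim (m≢1+n+m _ {n = 1} (trans (sym q) (trans r (cong suc p))))
  ... | inj₂ (p , V<U) | inj₂ (q , _)   | inj₂ (r , _)   = ⊥-elim (m≢1+n+m _ {n = 0} (trans (sym q) (trans r (cong suc p))))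

  π-Cyc⇒< : ∀ {u v w} → u < v → v < n + u → u < w → w < n + u → Cyc (π u) (π v) (π w) → v < w
  π-Cyc⇒< {u} {v} {w} u<v v<n+u u<w w<n+u c with <-cmp v w
  ... | tri< v<w _ _  = v<w
  ... | tri≈ _ refl _ = ⊥-elim (Cyc-irrefl c)
  ... | tri> _ _ w<v  = ⊥-elim (Cyc-asym c (π-Cyc u<w w<v v<n+u))

  lift-point : ∀ u (x : Fin n) → ∃[ t ] (u ≤ t × t < n + u × π t ≡ x)
  lift-point u x with toℕ (π u) ≤? toℕ x
  ... | yes U≤X = u / n * n + toℕ x
    , subst (_≤ u / n * n + toℕ x) (sym (trans (decompose u) (+-comm (toℕ (π u)) _))) (+-monoʳ-≤ (u / n * n) U≤X)
    , (begin-strict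
        u / n * n + toℕ x             <⟨ +-monoʳ-< (u / n * n) (toℕ<n x) ⟩
        u / n * n + n                 ≡⟨ +-comm (u / n * n) n ⟩
        n + u / n * n                 ≤⟨ +-monoʳ-≤ n (m≤n+m _ (toℕ (π u))) ⟩
        n + (toℕ (π u) + u / n * n)   ≡⟨ cong (n +_) (decompose u) ⟨
        n + u                         ∎)
    , trans (π-+ (u / n) (toℕ x)) (π-toℕ x)
    where open ≤-Reasoning
  ... | no  U≰X = suc (u / n) * n + toℕ x
    , (begin
        u                             ≡⟨ decompose u ⟩
        toℕ (π u) + u / n * n         ≤⟨ +-monoˡ-≤ _ (<⇒≤ (toℕ<n (π u))) ⟩
        suc (u / n) * n               ≤⟨ m≤m+n _ (toℕ x) ⟩
        suc (u / n) * n + toℕ x       ∎)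
    , (begin-strict
        suc (u / n) * n + toℕ x       <⟨ +-monoʳ-< (suc (u / n) * n) (≰⇒> U≰X) ⟩
        suc (u / n) * n + toℕ (π u)   ≡⟨ +-assoc n _ _ ⟩
        n + (u / n * n + toℕ (π u))   ≡⟨ cong (n +_) (trans (+-comm (u / n * n) _) (sym (decompose u))) ⟩
        n + u                         ∎)
    , trans (π-+ (suc (u / n)) (toℕ x)) (π-toℕ x)
    where open ≤-Reasoning

-- Bounded induction and gluing of sequences.

-- Used to carry a hypothetical violation of an inequality up to the last index `k`, where it
-- contradicts periodicity.
climb : ∀ {k} (Q : ℕ → Set) → (∀ {j} → j < k → Q j → Q (suc j)) → ∀ {j} → j ≤ k → Q j → Q k
climb {k} Q up {j} j≤k = go (k ∸ j) (m∸n+n≡m j≤k)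
  where
  go : ∀ r {j} → r + j ≡ k → Q j → Q k
  go zero    refl q = q
  go (suc r) {j} eq q = go r (trans (+-suc r j) eq) (up (subst (j <_) eq (s≤s (m≤n+m j r))) q)

-- Recursion on both indices, instead of a comparison of `i` with `j`, lets monotonicity and
-- pointwise properties follow by the same recursion. Index `j` itself still belongs to `f`.
glue : ℕ → (f g : ℕ → ℕ) → ℕ → ℕ
glue j       f g zero    = f 0
glue zero    f g (suc i) = g (suc i)
glue (suc j) f g (suc i) = glue j (f ∘ suc) (g ∘ suc) i

glue-step : ∀ j {f g} → (∀ i → f i < f (suc i)) → (∀ i → g i < g (suc i)) →
  f j < g (suc j) → ∀ i → glue j f g i < glue j f g (suc i)
glue-step zero    f↑ g↑ f<g zero          = f<g
glue-step zero    f↑ g↑ f<g (suc i)       = g↑ (suc i)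
glue-step (suc j) f↑ g↑ f<g zero          = f↑ 0
glue-step (suc j) f↑ g↑ f<g (suc i)       = glue-step j (f↑ ∘ suc) (g↑ ∘ suc) f<g i

glue-edges : ∀ {P : ℕ → ℕ → Set} j {f f' g g'} → (∀ i → P (f i) (f' i)) → (∀ i → P (g i) (g' i)) →
  ∀ i → P (glue j f g i) (glue j f' g' i)
glue-edges j       pf pg zero    = pf 0
glue-edges zero    pf pg (suc i) = pg (suc i)
glue-edges {P} (suc j) pf pg (suc i) = glue-edges {P} j (pf ∘ suc) (pg ∘ suc) i

glue-above : ∀ {j i} {f g} → j < i → glue j f g i ≡ g i
glue-above {zero}  {suc i} _         = refl
glue-above {suc j} {suc i} (s≤s j<i) = glue-above {j} {i} j<i

CrossingFree-∪-comm : ∀ {n ℓ} (E F : EdgeSet n) → CrossingFree ℓ (E ∪ F) → CrossingFree ℓ (F ∪ E)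
CrossingFree-∪-comm E F cf (p , q , edges , cross) = cf (p , q , ⊎-map swap swap ∘ edges , cross)

-- Unrolled stars and the crossings built from their chords.

module Lifts (n k : ℕ) .{{_ : NonZero n}} where
  open Circle n

  2k+1 : ℕ
  2k+1 = suc (k + k)

  -- The vertices s₀ ≺ s₁ ≺ … of a k-star, unrolled to an increasing periodic sequence of
  -- points of the universal cover.
  record Lift (E : EdgeSet n) : Set where
    field
      pt     : ℕ → ℕ
      step   : ∀ i → pt i < pt (suc i)
      period : ∀ i → pt (2k+1 + i) ≡ n + pt i
      edge   : ∀ i → E (π (pt i)) (π (pt (k + i)))
      cover  : ∀ {x y} → E x y → ∃[ i ] (x ≡ π (pt i) × y ≡ π (pt (k + i)))

    open Increasing step public

    periods : ∀ q i → pt (q * 2k+1 + i) ≡ q * n + pt i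
    periods zero    i = refl
    periods (suc q) i = begin
      pt (2k+1 + q * 2k+1 + i)   ≡⟨ cong pt (+-assoc 2k+1 (q * 2k+1) i) ⟩
      pt (2k+1 + (q * 2k+1 + i)) ≡⟨ period _ ⟩
      n + pt (q * 2k+1 + i)      ≡⟨ cong (n +_) (periods q i) ⟩
      n + (q * n + pt i)         ≡⟨ +-assoc n _ _ ⟨
      n + q * n + pt i           ∎
      where open ≡-Reasoning

    π-periods : ∀ q i → π (pt (q * 2k+1 + i)) ≡ π (pt i)
    π-periods q i = trans (cong π (periods q i)) (π-+ q (pt i))

    half-turns : ∀ i → pt (suc k + (k + i)) ≡ n + pt i
    half-turns i = trans (cong (pt ∘ suc) (sym (+-assoc k k i))) (period i)

    half-turns' : ∀ i → pt (k + (suc k + i)) ≡ n + pt i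
    half-turns' i = trans (cong pt (+-suc k (k + i))) (half-turns i)

    <turn : ∀ {d} i → d < 2k+1 → pt (d + i) < n + pt i
    <turn {d} i d<2k+1 = subst (pt (d + i) <_) (period i) (mono-< (+-monoˡ-< i d<2k+1))

    -- Lifts of one vertex differ by whole turns; `periods` and `injective` convert these into whole
    -- periods of the index, which survive adding `d`.
    π-index : ∀ {i j} → π (pt i) ≡ π (pt j) → ∀ d → π (pt (d + i)) ≡ π (pt (d + j))
    π-index {i} {j} eq d with π-≡⇒ eq
    ... | q , q' , eq' = begin
      π (pt (d + i))               ≡⟨ π-periods q (d + i) ⟨
      π (pt (q * 2k+1 + (d + i)))  ≡⟨ cong (π ∘ pt) (+-exchange (q * 2k+1) d i) ⟩
      π (pt (d + (q * 2k+1 + i)))  ≡⟨ cong (λ z → π (pt (d + z))) (injective (trans (periods q i) (trans eq' (sym (periods q' j))))) ⟩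
      π (pt (d + (q' * 2k+1 + j))) ≡⟨ cong (π ∘ pt) (+-exchange (q' * 2k+1) d j) ⟨
      π (pt (q' * 2k+1 + (d + j))) ≡⟨ π-periods q' (d + j) ⟩
      π (pt (d + j))               ∎
      where
      open ≡-Reasoning

    -- Each vertex lies on two edges: the one starting at `i`, and the one starting at `i + k + 1`,
    -- which ends at `i` one turn later. Keeping the offset `d` as a parameter lets `splice` use
    -- either kind.
    chord : ∀ {d} → d ≡ k ⊎ d ≡ suc k → ∀ i → E ∋[ π (pt i) , π (pt (d + i)) ]
    chord (inj₁ refl) i = inj₁ (edge i)
    chord (inj₂ refl) i = inj₂ (subst (E _) (trans (cong π (half-turns' i)) (π-turn (pt i))) (edge (suc k + i)))

  open Lift

  shift : ∀ {E} → ℕ → Lift E → Lift E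
  shift u A .pt i     = pt A (i + u)
  shift u A .step i   = step A (i + u)
  shift u A .period i = trans (cong (pt A) (+-assoc 2k+1 i u)) (period A (i + u))
  shift {E} u A .edge i = subst (λ z → E (π (pt A (i + u))) (π (pt A z))) (sym (+-assoc k i u)) (edge A (i + u))
  shift u A .cover exy with cover A exy
  -- Subtracting `u` from the index is avoided: after adding `u`, the witness is `i` plus `u` whole
  -- periods.
  ... | i , refl , refl = u * (k + k) + i
    , sym (trans (cong (π ∘ pt A) (regroup u (k + k) i)) (π-periods A u i))
    , sym (trans (cong (π ∘ pt A) (trans (cong (_+ u) (+-exchange k _ i)) (regroup u (k + k) (k + i)))) (π-periods A u (k + i)))
    where
    regroup : ∀ u t i → u * t + i + u ≡ u * suc t + i
    regroup = solve-∀

  -- All points of `p` precede all points of `q` within one turn, and both sequences increase, so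
  -- any two of the chords interleave.
  crossing : ∀ {G : EdgeSet n} {p q : ℕ → ℕ} → (∀ i → G ∋[ π (p i) , π (q i) ]) →
    (∀ i → p i < p (suc i)) → (∀ i → q i < q (suc i)) → p k < q 0 → q k < n + p 0 →
    HasCrossing (suc k) G
  crossing {G} {p} {q} edges p↑ q↑ pk<q0 qk<n+p0 =
    (π ∘ p ∘ toℕ) , (π ∘ q ∘ toℕ) , (edges ∘ toℕ) , cross
    where
    module P = Increasing p↑
    module Q = Increasing q↑
    p<q : ∀ (i j : Fin (suc k)) → p (toℕ i) < q (toℕ j)
    p<q i j = <-≤-trans (≤-<-trans (P.mono-≤ (m<1+n⇒m≤n (toℕ<n i))) pk<q0) (Q.mono-≤ z≤n)
    q<n+p : ∀ (i j : Fin (suc k)) → q (toℕ i) < n + p (toℕ j)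
    q<n+p i j = <-≤-trans (≤-<-trans (Q.mono-≤ (m<1+n⇒m≤n (toℕ<n i))) qk<n+p0) (+-monoʳ-≤ n (P.mono-≤ z≤n))
    cross : ∀ i j → i ≢ j → Cross (π (p (toℕ i))) (π (q (toℕ i))) (π (p (toℕ j))) (π (q (toℕ j)))
    cross i j i≢j with <-cmp (toℕ i) (toℕ j)
    ... | tri< i<j _ _ = inj₁ (π-Cyc (P.mono-< i<j) (p<q j i) (q<n+p i i) , π-Cyc (p<q i i) (Q.mono-< i<j) (q<n+p j i))
    ... | tri≈ _ eq _  = ⊥-elim (i≢j (toℕ-injective eq))
    ... | tri> _ _ j<i = inj₂ (π-Cyc (p<q i j) (Q.mono-< j<i) (q<n+p i i)
        , Cyc-rotate (π-Cyc (P.mono-< j<i) (p<q i i) (q<n+p i j)))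

  -- The chords 0, …, j of the first star and j+1, …, k of the second.
  splice : ∀ {E F} (A : Lift E) (B : Lift F) → CrossingFree (suc k) (E ∪ F) →
    ∀ {d e j} → d ≡ k ⊎ d ≡ suc k → e ≡ k ⊎ e ≡ suc k → j < k →
    pt A j < pt B (suc j) → pt A (d + j) < pt B (e + suc j) →
    pt B k < pt A d → pt B (e + k) < n + pt A 0 → ⊥
  splice {E} {F} A B cf {d} {e} {j} hd he j<k h₁ h₂ h₃ h₄ = cf (crossing {G = E ∪ F}
    (glue-edges {P = λ u v → (E ∪ F) ∋[ π u , π v ]} j
      (λ i → ⊎-map inj₁ inj₁ (chord A hd i)) (λ i → ⊎-map inj₂ inj₂ (chord B he i)))
    (glue-step j (step A) (step B) h₁)
    (glue-step j (far-step A d) (far-step B e) h₂)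
    (subst₂ _<_ (sym (glue-above j<k)) (cong (pt A) (sym (+-identityʳ d))) h₃)
    (subst (_< n + pt A 0) (sym (glue-above j<k)) h₄))
    where
    far-step : ∀ {E} (A : Lift E) d i → pt A (d + i) < pt A (d + suc i)
    far-step A d i = subst (λ z → pt A (d + i) < pt A z) (sym (+-suc d i)) (step A (d + i))

  agree⇒SameEdgeSet : ∀ {E F} (A : Lift E) (B : Lift F) → (∀ i → pt A i ≡ pt B i) → SameEdgeSet E F
  agree⇒SameEdgeSet A B A≡B x y = ⊎-map (transfer A B A≡B) (transfer A B A≡B)
                                , ⊎-map (transfer B A (sym ∘ A≡B)) (transfer B A (sym ∘ A≡B))
    where
    transfer : ∀ {E F} (A : Lift E) (B : Lift F) → (∀ i → pt A i ≡ pt B i) → ∀ {x y} → E x y → F x y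
    transfer {F = F} A B A≡B exy with cover A exy
    ... | i , refl , refl = subst₂ (λ u v → F (π u) (π v)) (sym (A≡B i)) (sym (A≡B (k + i))) (edge B i)

  -- Two stars whose angles at a common vertex overlap.

  module SharedAngle {E F} (A : Lift E) (B : Lift F) (cf : CrossingFree (suc k) (E ∪ F))
    (a₀≡b₀ : pt A 0 ≡ pt B 0) (aₖ<bₖ₊₁ : pt A k < pt B (suc k)) (bₖ<aₖ₊₁ : pt B k < pt A (suc k)) where

    -- Otherwise the chords `[a(i), a(k+1+i)]` for `i ≤ j` and `[b(i), b(k+i)]` for `j < i ≤ k` form
    -- a (k+1)-crossing.
    far-<⇒ : ∀ {j} → j < k → pt A (suc k + j) < pt B (suc k + j) → pt B (suc j) ≤ pt A j
    far-<⇒ {j} j<k lt = ≮⇒≥ λ aⱼ<bⱼ₊₁ → splice A B cf (inj₂ refl) (inj₁ refl) j<k aⱼ<bⱼ₊₁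
      (subst (λ z → pt A (suc k + j) < pt B z) (sym (+-suc k j)) lt) bₖ<aₖ₊₁
      (subst₂ (λ x y → pt B x < n + y) (+-identityʳ (k + k)) (sym a₀≡b₀) (<turn B 0 ≤-refl))

    -- Otherwise the chords `[a(i+1), a(k+i+1)]` for `i ≤ j` and `[b(i), b(k+1+i)]` for `j < i ≤ k`
    -- form a (k+1)-crossing.
    near-<⇒ : ∀ {j} → j < k → pt A (suc j) < pt B (suc j) → pt B (suc k + suc j) ≤ pt A (k + suc j)
    near-<⇒ {j} j<k lt = ≮⇒≥ λ far → splice (shift 1 A) B cf (inj₁ refl) (inj₂ refl) j<k
      (subst (λ z → pt A z < pt B (suc j)) (+-comm 1 j) lt)
      (subst (λ z → pt A z < pt B (suc k + suc j)) (trans (cong (k +_) (+-comm 1 j)) (sym (+-assoc k j 1))) far)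
      (subst (λ z → pt B k < pt A z) (+-comm 1 k) bₖ<aₖ₊₁)
      (subst (_< n + pt A 1) (sym (trans (cong (pt B) (sym (+-identityʳ 2k+1))) (period B 0)))
        (+-monoʳ-< n (subst (_< pt A 1) a₀≡b₀ (step A 0))))

  shared-angle⇒agree : ∀ {E F} (A : Lift E) (B : Lift F) → CrossingFree (suc k) (E ∪ F) →
    pt A 0 ≡ pt B 0 → pt A k < pt B (suc k) → pt B k < pt A (suc k) → ∀ i → pt A i ≡ pt B i
  shared-angle⇒agree {E} {F} A B cf a₀≡b₀ aₖ<bₖ₊₁ bₖ<aₖ₊₁ i = begin
    pt A i                                   ≡⟨ cong (pt A) (split i) ⟩
    pt A (i / 2k+1 * 2k+1 + i % 2k+1)        ≡⟨ periods A (i / 2k+1) _ ⟩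
    i / 2k+1 * n + pt A (i % 2k+1)           ≡⟨ cong (i / 2k+1 * n +_) (one-turn (m%n<n i 2k+1)) ⟩
    i / 2k+1 * n + pt B (i % 2k+1)           ≡⟨ periods B (i / 2k+1) _ ⟨
    pt B (i / 2k+1 * 2k+1 + i % 2k+1)        ≡⟨ cong (pt B) (split i) ⟨
    pt B i                                   ∎
    where
    open ≡-Reasoning

    split : ∀ i → i ≡ i / 2k+1 * 2k+1 + i % 2k+1
    split i = trans (m≡m%n+[m/n]*n i 2k+1) (+-comm (i % 2k+1) _)

    -- A violation `a(j) < b(j)` passes to `j + 1`: `near-<⇒` moves it to the far ends, and `far-<⇒`
    -- with the stars exchanged moves it back. At `k` it would give `b(2k+1) ≤ a(2k)`, although `a`
    -- and `b` complete their turn at the same point.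
    near-≥ : ∀ {E F} (A : Lift E) (B : Lift F) → CrossingFree (suc k) (E ∪ F) →
      pt A 0 ≡ pt B 0 → pt A k < pt B (suc k) → pt B k < pt A (suc k) → ∀ {j} → j ≤ k → pt B j ≤ pt A j
    near-≥ {E} {F} A B cf a₀≡b₀ aₖ<bₖ₊₁ bₖ<aₖ₊₁ j≤k = ≮⇒≥ λ lt → top (climb (λ j → pt A j < pt B j) up j≤k lt)
      where
      module AB = SharedAngle A B cf a₀≡b₀ aₖ<bₖ₊₁ bₖ<aₖ₊₁
      module BA = SharedAngle B A (CrossingFree-∪-comm E F cf) (sym a₀≡b₀) bₖ<aₖ₊₁ aₖ<bₖ₊₁
      up : ∀ {j} → j < k → pt A j < pt B j → pt A (suc j) < pt B (suc j)
      up {zero}  _   lt = ⊥-elim (<⇒≢ lt a₀≡b₀)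
      up {suc j} j<k lt = ≤-<-trans
        (BA.far-<⇒ j<k (≤-<-trans (AB.near-<⇒ (<-trans (n<1+n j) j<k) lt) (step A (k + suc j))))
        (step B (suc j))
      top : ¬ (pt A k < pt B k)
      top = top' k refl
        where
        top' : ∀ j → j ≡ k → ¬ (pt A j < pt B j)
        top' zero    _    lt = <⇒≢ lt a₀≡b₀
        top' (suc j) refl lt = <⇒≱ (subst (pt A (k + k) <_)
          (trans (cong (pt A) (sym (+-identityʳ 2k+1))) (trans (period A 0) (trans (cong (n +_) a₀≡b₀)
            (trans (sym (period B 0)) (cong (pt B) (+-identityʳ 2k+1))))))
          (step A (k + k))) (AB.near-<⇒ ≤-refl lt)

    near : ∀ {j} → j ≤ k → pt A j ≡ pt B j
    near j≤k = ≤-antisym (near-≥ B A (CrossingFree-∪-comm E F cf) (sym a₀≡b₀) bₖ<aₖ₊₁ aₖ<bₖ₊₁ j≤k)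
                         (near-≥ A B cf a₀≡b₀ aₖ<bₖ₊₁ bₖ<aₖ₊₁ j≤k)

    -- As the near halves agree, a strict inequality here would, by `far-<⇒`, put a vertex of a near
    -- half at or before its predecessor.
    far : ∀ {j} → j < k → pt A (suc k + j) ≡ pt B (suc k + j)
    far {j} j<k = ≤-antisym
      (≮⇒≥ λ lt → <⇒≱ (step A j)
        (subst (pt A (suc j) ≤_) (sym (near (<⇒≤ j<k))) (SharedAngle.far-<⇒ B A (CrossingFree-∪-comm E F cf) (sym a₀≡b₀) bₖ<aₖ₊₁ aₖ<bₖ₊₁ j<k lt)))
      (≮⇒≥ λ lt → <⇒≱ (step B j)
        (subst (pt B (suc j) ≤_) (near (<⇒≤ j<k)) (SharedAngle.far-<⇒ A B cf a₀≡b₀ aₖ<bₖ₊₁ bₖ<aₖ₊₁ j<k lt)))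

    one-turn : ∀ {r} → r < 2k+1 → pt A r ≡ pt B r
    one-turn {r} r<2k+1 with r ≤? k
    ... | yes r≤k = near r≤k
    ... | no  r≰k with m≤n⇒∃[o]m+o≡n (≰⇒> r≰k)
    ...   | j , refl = far (+-cancelˡ-< (suc k) j k r<2k+1)

  shared-angle⇒SameEdgeSet : ∀ {E F} (A : Lift E) (B : Lift F) → CrossingFree (suc k) (E ∪ F) →
    ∀ {i j} → pt A i ≡ pt B j → pt A (k + i) < pt B (suc k + j) → pt B (k + j) < pt A (suc k + i) →
    SameEdgeSet E F
  shared-angle⇒SameEdgeSet A B cf {i} {j} h₁ h₂ h₃ =
    agree⇒SameEdgeSet (shift i A) (shift j B) (shared-angle⇒agree (shift i A) (shift j B) cf h₁ h₂ h₃)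

  -- Uniqueness of the opposite pair.

  -- The edge from pt A i to pt B (k+1+j) is a bisector of both stars, at opposite ends.
  Opposite : ∀ {E F} → Lift E → Lift F → ℕ → ℕ → Set
  Opposite A B i j = (pt B j < pt A i × pt A i < pt B (suc j)) ×
                     (pt A (k + i) < pt B (suc k + j) × pt B (suc k + j) < pt A (suc k + i))

  module AroundOpposite {E F} (A : Lift E) (B : Lift F) (cf : CrossingFree (suc k) (E ∪ F))
    (b₀<a₀ : pt B 0 < pt A 0) (a₀<b₁ : pt A 0 < pt B 1)
    (aₖ<bₖ₊₁ : pt A k < pt B (suc k)) (bₖ₊₁<aₖ₊₁ : pt B (suc k) < pt A (suc k)) where

    private
      turn : ∀ {E} (A : Lift E) → pt A (suc k + k) ≡ n + pt A 0
      turn A = trans (cong (pt A) (sym (+-identityʳ 2k+1))) (period A 0)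

    -- Otherwise the chords `[a(i), a(k+1+i)]` for `i ≤ j` and `[b(i), b(k+1+i)]` for `j < i ≤ k`
    -- form a (k+1)-crossing.
    far-<⇒ : ∀ {j} → j < k → pt A (suc k + j) < pt B (suc k + suc j) → pt B (suc j) ≤ pt A j
    far-<⇒ j<k far = ≮⇒≥ λ near → splice A B cf (inj₂ refl) (inj₂ refl) j<k near far
      (<-trans (step B k) bₖ₊₁<aₖ₊₁)
      (subst (_< n + pt A 0) (sym (turn B)) (+-monoʳ-< n b₀<a₀))

    -- Otherwise the chords `[b(i+1), b(k+2+i)]` for `i ≤ j` and `[a(i), a(k+1+i)]` for `j < i ≤ k`
    -- form a (k+1)-crossing.
    near-<⇒ : ∀ {j} → j < k → pt B (suc j) < pt A (suc j) → pt A (suc k + suc j) ≤ pt B (suc k + suc j)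
    near-<⇒ {j} j<k near = ≮⇒≥ λ far →
      splice (shift 1 B) A (CrossingFree-∪-comm E F cf) (inj₂ refl) (inj₂ refl) j<k
        (subst (λ z → pt B z < pt A (suc j)) (+-comm 1 j) near)
        (subst (λ z → pt B z < pt A (suc k + suc j))
          (trans (cong (suc k +_) (+-comm 1 j)) (sym (+-assoc (suc k) j 1))) far)
        (<-trans aₖ<bₖ₊₁ (subst (λ z → pt B (suc k) < pt B z) (+-comm 1 (suc k)) (step B (suc k))))
        (subst (_< n + pt B 1) (sym (turn A)) (+-monoʳ-< n a₀<b₁))

    -- A violation `b(j) < a(j)` climbs to `k` by alternating `near-<⇒` and `far-<⇒`, and there
    -- yields `a(2k+1) ≤ b(2k+1)`, one turn after `b(0) < a(0)`.
    near-≤ : ∀ {j} → 0 < j → j ≤ k → pt A j ≤ pt B j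
    near-≤ 0<j j≤k = ≮⇒≥ λ lt → top k refl (climb (λ j → 0 < j × pt B j < pt A j) up j≤k (0<j , lt))
      where
      up : ∀ {j} → j < k → 0 < j × pt B j < pt A j → 0 < suc j × pt B (suc j) < pt A (suc j)
      up {suc j} j<k (_ , lt) = s≤s z≤n , ≤-<-trans
        (far-<⇒ j<k (≤-<-trans (near-<⇒ (<-trans (n<1+n j) j<k) lt)
          (subst (λ z → pt B (suc k + suc j) < pt B z) (sym (+-suc (suc k) (suc j))) (step B (suc k + suc j)))))
        (step A (suc j))
      top : ∀ j → j ≡ k → ¬ (0 < j × pt B j < pt A j)
      top (suc j) refl (_ , lt) = <⇒≱ b₀<a₀ (+-cancelˡ-≤ n _ _ (subst₂ _≤_ (turn A) (turn B) (near-<⇒ ≤-refl lt)))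

    -- A violation would give `b(j+1) ≤ a(j) < a(j+1)`, against `near-≤`.
    far-≤ : ∀ {j} → j < k → pt B (suc k + suc j) ≤ pt A (suc k + j)
    far-≤ {j} j<k = ≮⇒≥ λ far → <⇒≱ (step A j) (≤-trans (near-≤ (s≤s z≤n) j<k) (far-<⇒ j<k far))

  Opposite-periods : ∀ {E F} (A : Lift E) (B : Lift F) q {i j} →
    Opposite A B i j → Opposite A B (q * 2k+1 + i) (q * 2k+1 + j)
  Opposite-periods A B q {i} {j} ((h₁ , h₂) , (h₃ , h₄)) =
    (move B A 0 0 h₁ , move A B 0 1 h₂) , (move A B k (suc k) h₃ , move B A (suc k) (suc k) h₄)
    where
    move : ∀ {E F} (A : Lift E) (B : Lift F) c d {i j} → pt A (c + i) < pt B (d + j) →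
      pt A (c + (q * 2k+1 + i)) < pt B (d + (q * 2k+1 + j))
    move A B c d {i} {j} lt = subst₂ _<_
      (trans (sym (periods A q (c + i))) (cong (pt A) (+-exchange (q * 2k+1) c i)))
      (trans (sym (periods B q (d + j))) (cong (pt B) (+-exchange (q * 2k+1) d j)))
      (+-monoʳ-< (q * n) lt)

  same-bracket : ∀ {F} (B : Lift F) {v c d} → pt B c < v → v < pt B (suc c) → pt B d < v → v < pt B (suc d) → c ≡ d
  same-bracket B c<v v<c d<v v<d = ≤-antisym (m<1+n⇒m≤n (cancel-< B (<-trans c<v v<d))) (m<1+n⇒m≤n (cancel-< B (<-trans d<v v<c)))

  module _ {E F} (A : Lift E) (B : Lift F) (cf : CrossingFree (suc k) (E ∪ F)) where

    -- With the first pair moved to index 0, a nonzero `δ` makes the inequalities of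
    -- `AroundOpposite` bound `j'` strictly from above and from below by the same number.
    Opposite-unique-near : ∀ {i j j'} δ → δ < 2k+1 → Opposite A B i j → Opposite A B (δ + i) j' → δ ≡ 0 × j ≡ j'
    Opposite-unique-near {i} {j} {j'} δ δ<2k+1 ((h₁ , h₂) , (h₃ , h₄)) ((g₁ , g₂) , (g₃ , g₄)) = cases δ δ<2k+1 g₁ g₂ g₃ g₄
      where
      open AroundOpposite (shift i A) (shift j B) cf h₁ h₂ h₃ h₄
      cases : ∀ δ → δ < 2k+1 → pt B j' < pt A (δ + i) → pt A (δ + i) < pt B (suc j') →
        pt A (k + (δ + i)) < pt B (suc k + j') → pt B (suc k + j') < pt A (suc k + (δ + i)) → δ ≡ 0 × j ≡ j'
      cases zero _ g₁ g₂ _ _ = refl , same-bracket B h₁ h₂ g₁ g₂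
      cases (suc δ) δ<2k+1 g₁ g₂ g₃ g₄ with suc δ ≤? k
      -- `near-≤` with `g₁` gives `j' < suc δ + j`, whereas `far-≤` with `g₃` gives
      -- `suc δ + j < j'`.
      ... | yes δ≤k = ⊥-elim (<-asym
              (cancel-< B (<-≤-trans g₁ (near-≤ (s≤s z≤n) δ≤k)))
              (+-cancelˡ-< (suc k) _ _ (cancel-< B (≤-<-trans
                (≤-trans (≤-reflexive (cong (pt B) (sym (+-assoc (suc k) (suc δ) j)))) (≤-trans (far-≤ δ≤k) (≤-reflexive (cong (pt A) (regroup k δ i)))))
                g₃))))
        where
        regroup : ∀ k δ i → suc k + δ + i ≡ k + (suc δ + i)
        regroup = solve-∀
      -- Beyond `k` the roles change: `far-≤` with `g₂` bounds `j'` from below, and `near-≤`, read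
      -- one turn later, with `g₄` bounds it from above.
      ... | no  δ≰k with m≤n⇒∃[o]m+o≡n (≰⇒> δ≰k)
      ...   | μ , eq = ⊥-elim (<-asym below above)
        where
        μ<k : μ < k
        μ<k = +-cancelˡ-< (suc k) μ k (subst (_< 2k+1) (sym eq) δ<2k+1)
        below : suc k + (μ + j) < j'
        below = m<1+n⇒m≤n (cancel-< B (≤-<-trans
          (≤-trans (≤-reflexive (cong (pt B) (regroup k μ j))) (≤-trans (far-≤ μ<k) (≤-reflexive (cong (λ z → pt A (z + i)) eq)))) g₂))
          where
          regroup : ∀ k μ j → suc (suc k + (μ + j)) ≡ suc k + suc μ + j
          regroup = solve-∀
        above : j' < suc k + (μ + j)
        above = +-cancelˡ-< (suc k) _ _ (cancel-< B (<-≤-trans g₄ (begin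
          pt A (suc k + (suc δ + i))           ≡⟨ cong (λ z → pt A (suc k + (z + i))) eq ⟨
          pt A (suc k + (suc k + μ + i))       ≡⟨ cong (pt A) (regroup k μ i) ⟩
          pt A (suc k + (k + (suc μ + i)))     ≡⟨ half-turns A (suc μ + i) ⟩
          n + pt A (suc μ + i)                 ≤⟨ +-monoʳ-≤ n (near-≤ (s≤s z≤n) μ<k) ⟩
          n + pt B (suc μ + j)                 ≡⟨ half-turns B (suc μ + j) ⟨
          pt B (suc k + (k + (suc μ + j)))     ≡⟨ cong (pt B) (regroup' k μ j) ⟩
          pt B (suc k + (suc k + (μ + j)))     ∎)))
          where
          open ≤-Reasoning
          regroup : ∀ k μ i → suc k + (suc k + μ + i) ≡ suc k + (k + (suc μ + i))
          regroup = solve-∀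
          regroup' : ∀ k μ i → suc k + (k + (suc μ + i)) ≡ suc k + (suc k + (μ + i))
          regroup' = solve-∀

    Opposite-unique : ∀ {i j i' j'} → Opposite A B i j → Opposite A B i' j' →
      π (pt A i') ≡ π (pt A i) × π (pt B (suc k + j')) ≡ π (pt B (suc k + j))
    Opposite-unique {i} {j} {i'} {j'} opp opp' =
      -- Adding `i` periods to the second pair puts its index at or beyond `i`. The gap then splits
      -- into `q` whole periods, by which the first pair is moved, and a remainder `δ` shorter than
      -- a period.
      let i≤ : i ≤ i * 2k+1 + i'
          i≤ = ≤-trans (m≤m*n i 2k+1) (m≤m+n _ i')
          gap , eq = m≤n⇒∃[o]m+o≡n i≤
          q = gap / 2k+1
          δ = gap % 2k+1
          place : i * 2k+1 + i' ≡ δ + (q * 2k+1 + i)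
          place = trans (sym eq) (trans (cong (i +_) (m≡m%n+[m/n]*n gap 2k+1)) (regroup i δ (q * 2k+1)))
          δ≡0 , j≡ = Opposite-unique-near δ (m%n<n gap 2k+1) (Opposite-periods A B q opp)
                       (subst (λ z → Opposite A B z (i * 2k+1 + j')) place (Opposite-periods A B i opp'))
          same : i * 2k+1 + i' ≡ q * 2k+1 + i
          same = trans place (cong (_+ (q * 2k+1 + i)) δ≡0)
      in trans (sym (π-periods A i i')) (trans (cong (π ∘ pt A) same) (π-periods A q i))
       , trans (π-index B (sym (π-periods B i j')) (suc k)) (trans (cong (λ z → π (pt B (suc k + z))) (sym j≡)) (π-index B (π-periods B q j) (suc k)))
      where
      regroup : ∀ i δ x → i + (δ + x) ≡ δ + (x + i)
      regroup = solve-∀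

  -- Existence of an opposite pair.

  module Existence {E F} (A : Lift E) (B : Lift F) (b₀<a : ∀ i → pt B 0 < pt A i) where

    c : ℕ → ℕ
    c i = proj₁ (bracket B (b₀<a i))

    c-below : ∀ i → pt B (c i) < pt A i
    c-below i = proj₁ (proj₂ (bracket B (b₀<a i)))

    c-above : ∀ i → pt A i ≤ pt B (suc (c i))
    c-above i = proj₂ (proj₂ (bracket B (b₀<a i)))

    c-bound : ∀ {i d} → pt B d < pt A i → d ≤ c i
    c-bound {i} bd<ai = m<1+n⇒m≤n (cancel-< B (<-≤-trans bd<ai (c-above i)))

    c-mono : ∀ {i j} → i ≤ j → c i ≤ c j
    c-mono {i} i≤j = c-bound (<-≤-trans (c-below i) (mono-≤ A i≤j))

    c-periods : ∀ q i → c (q * 2k+1 + i) ≡ q * 2k+1 + c i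
    c-periods q i = ≤-antisym
      (m<1+n⇒m≤n (subst (c (q * 2k+1 + i) <_) (+-suc (q * 2k+1) (c i)) (cancel-< B (<-≤-trans (c-below (q * 2k+1 + i))
        (subst₂ _≤_ (sym (periods A q i)) (sym (periods B q (suc (c i)))) (+-monoʳ-≤ (q * n) (c-above i)))))))
      (c-bound (subst₂ _<_ (sym (periods B q (c i))) (sym (periods A q i)) (+-monoʳ-< (q * n) (c-below i))))

    -- Ties are allowed where `bracket` and the failure of `Behind` give only non-strict bounds;
    -- `opposite` removes them with the help of crossing-freeness.
    WeaklyOpposite : ℕ → ℕ → Set
    WeaklyOpposite i j = (pt B j < pt A i × pt A i ≤ pt B (suc j)) ×
                         (pt A (k + i) ≤ pt B (suc k + j) × pt B (suc k + j) < pt A (suc k + i))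

    -- At the vertex a i, the halving edge of the second star lies clockwise of the angle of the first.
    Behind : ℕ → Set
    Behind i = suc k + c i ≤ c (k + i)

    -- Two occurrences in a row would advance `c` by at least `2k + 2` over `2k` indices, while a
    -- whole period advances it by only `2k + 1`.
    Behind-alternates : ∀ {i} → Behind i → ¬ Behind (k + i)
    Behind-alternates {i} p q = <-irrefl refl (begin-strict
      2k+1 + c i                <⟨ n<1+n _ ⟩
      suc 2k+1 + c i            ≡⟨ regroup k (c i) ⟩
      suc k + (suc k + c i)     ≤⟨ +-monoʳ-≤ (suc k) p ⟩
      suc k + c (k + i)         ≤⟨ q ⟩
      c (k + (k + i))           ≤⟨ c-mono (n≤1+n _) ⟩
      c (suc (k + (k + i)))     ≡⟨ cong c (regroup' k i) ⟩
      c (1 * 2k+1 + i)          ≡⟨ c-periods 1 i ⟩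
      1 * 2k+1 + c i            ≡⟨ cong (_+ c i) (+-identityʳ 2k+1) ⟩
      2k+1 + c i                ∎)
      where
      open ≤-Reasoning
      regroup : ∀ k x → suc (suc (k + k)) + x ≡ suc k + (suc k + x)
      regroup = solve-∀
      regroup' : ∀ k i → suc (k + (k + i)) ≡ 1 * suc (k + k) + i
      regroup' = solve-∀

    -- The edge at `a(k+i)` can reach too far only if `Behind i` holds, as a comparison one turn
    -- later shows. So if neither `Behind i` nor `Behind (k + i)` holds, the pair at `k + i` is
    -- weakly opposite.
    ¬Behind-alternates : ∀ {i} → ¬ Behind i → (∃[ i ] ∃[ j ] WeaklyOpposite i j) ⊎ Behind (k + i)
    ¬Behind-alternates {i} ¬p with suc k + c (k + i) ≤? c (k + (k + i))
    ... | yes q = inj₂ q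
    ... | no ¬q = inj₁ (k + i , c (k + i) , (c-below (k + i) , c-above (k + i))
        , ≮⇒≥ (λ lt → ¬q (c-bound lt))
        , (begin-strict
            pt B (suc k + c (k + i))   ≤⟨ mono-≤ B (+-monoʳ-≤ (suc k) (m<1+n⇒m≤n (≰⇒> ¬p))) ⟩
            pt B (suc k + (k + c i))   ≡⟨ half-turns B (c i) ⟩
            n + pt B (c i)             <⟨ +-monoʳ-< n (c-below i) ⟩
            n + pt A i                 ≡⟨ half-turns A i ⟨
            pt A (suc k + (k + i))     ∎))
        where open ≤-Reasoning

    -- Steps of `k` are taken in twos because a single one exchanges `Behind` with its negation. For
    -- `t = suc k` the index reached is `k + i` up to `k` whole periods, where `Behind` fails.
    Behind-even-steps : ∀ {i} → Behind i → ∀ t → (∃[ i ] ∃[ j ] WeaklyOpposite i j) ⊎ Behind (t * (k + k) + i)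
    Behind-even-steps p zero    = inj₂ p
    Behind-even-steps {i} p (suc t) with Behind-even-steps p t
    ... | inj₁ w = inj₁ w
    ... | inj₂ q with ¬Behind-alternates (Behind-alternates q)
    ...   | inj₁ w = inj₁ w
    ...   | inj₂ r = inj₂ (subst Behind (regroup k (t * (k + k)) i) r)
      where
      regroup : ∀ k x i → k + (k + (x + i)) ≡ k + k + x + i
      regroup = solve-∀

    Behind-periods : ∀ q {i} → Behind (q * 2k+1 + i) → Behind i
    Behind-periods q {i} p = +-cancelˡ-≤ (q * 2k+1) _ _ (begin
      q * 2k+1 + (suc k + c i)   ≡⟨ +-exchange (q * 2k+1) (suc k) (c i) ⟩
      suc k + (q * 2k+1 + c i)   ≡⟨ cong (suc k +_) (c-periods q i) ⟨
      suc k + c (q * 2k+1 + i)   ≤⟨ p ⟩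
      c (k + (q * 2k+1 + i))     ≡⟨ cong c (+-exchange (q * 2k+1) k i) ⟨
      c (q * 2k+1 + (k + i))     ≡⟨ c-periods q (k + i) ⟩
      q * 2k+1 + c (k + i)       ∎)
      where
      open ≤-Reasoning

    -- Without a weakly opposite pair, Behind would alternate along the steps i ↦ k + i, which is
    -- impossible since these return to their start, modulo 2k+1, after the odd number 2k+1 of steps.
    Behind⇒weakly-opposite : ∀ {i} → Behind i → ∃[ i ] ∃[ j ] WeaklyOpposite i j
    Behind⇒weakly-opposite {i} p with Behind-even-steps p (suc k)
    ... | inj₁ w = w
    ... | inj₂ q = ⊥-elim (Behind-alternates p (Behind-periods k (subst Behind (regroup k i) q)))
      where
      regroup : ∀ k i → suc k * (k + k) + i ≡ k * suc (k + k) + (k + i)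
      regroup = solve-∀

    weakly-opposite : ∃[ i ] ∃[ j ] WeaklyOpposite i j
    weakly-opposite with suc k + c 0 ≤? c (k + 0)
    ... | yes p = Behind⇒weakly-opposite p
    ... | no ¬p with ¬Behind-alternates ¬p
    ...   | inj₁ w = w
    ...   | inj₂ p = Behind⇒weakly-opposite p

  -- Equality in WeaklyOpposite would make the two stars share an angle.
  opposite : ∀ {E F} (A : Lift E) (B : Lift F) → CrossingFree (suc k) (E ∪ F) → ¬ SameEdgeSet E F →
    (∀ i → pt B 0 < pt A i) → ∃[ i ] ∃[ j ] Opposite A B i j
  opposite A B cf E≢F b₀<a with Existence.weakly-opposite A B b₀<a
  ... | i , j , (h₁ , h₂) , (h₃ , h₄) = i , j , (h₁ , ≤∧≢⇒< h₂ near≢) , (≤∧≢⇒< h₃ far≢ , h₄)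
    where
    open ≤-Reasoning
    near≢ : pt A i ≢ pt B (suc j)
    near≢ eq = E≢F (shared-angle⇒SameEdgeSet A B cf eq
      (≤-<-trans h₃ (mono-< B (+-monoʳ-< (suc k) (n<1+n j))))
      (subst (λ z → pt B z < pt A (suc k + i)) (sym (+-suc k j)) h₄))
    far≢ : pt A (k + i) ≢ pt B (suc k + j)
    far≢ eq = E≢F (shared-angle⇒SameEdgeSet A B cf eq
      (begin-strict
        pt A (k + (k + i))            <⟨ step A _ ⟩
        pt A (suc k + (k + i))        ≡⟨ half-turns A i ⟩
        n + pt A i                    ≤⟨ +-monoʳ-≤ n h₂ ⟩
        n + pt B (suc j)              ≡⟨ half-turns B (suc j) ⟨
        pt B (suc k + (k + suc j))    ≡⟨ cong (λ z → pt B (suc k + z)) (+-suc k j) ⟩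
        pt B (suc k + (suc k + j))    ∎)
      (begin-strict
        pt B (k + (suc k + j))        ≡⟨ half-turns' B j ⟩
        n + pt B j                    <⟨ +-monoʳ-< n h₁ ⟩
        n + pt A i                    ≡⟨ half-turns A i ⟨
        pt A (suc k + (k + i))        ∎))

  -- Bisectors expressed in the universal cover.

  Bisects : ∀ {E} → Lift E → ℕ → ℕ → Set
  Bisects A i t = pt A (k + i) < t × t < pt A (suc k + i)

  Bisects-periods : ∀ {E} (A : Lift E) q {i t} → Bisects A i t → Bisects A (q * 2k+1 + i) (q * n + t)
  Bisects-periods A q {i} {t} (h₁ , h₂) =
    subst (_< q * n + t) (move k) (+-monoʳ-< (q * n) h₁) , subst (q * n + t <_) (move (suc k)) (+-monoʳ-< (q * n) h₂)
    where
    move : ∀ d → q * n + pt A (d + i) ≡ pt A (d + (q * 2k+1 + i))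
    move d = trans (sym (periods A q (d + i))) (cong (pt A) (+-exchange (q * 2k+1) d i))

  module _ (1≤k : 1 ≤ k) where

    private
      suc-k<turn : suc k < 2k+1
      suc-k<turn = s≤s (m<m+n k 1≤k)

    Bisects-above : ∀ {E} (A : Lift E) {i t} → Bisects A i t → pt A i < t
    Bisects-above A (h₁ , _) = ≤-<-trans (mono-≤ A (m≤n+m _ k)) h₁

    Bisects-below : ∀ {E} (A : Lift E) {i t} → Bisects A i t → t < n + pt A i
    Bisects-below A {i} (_ , h₂) = <-trans h₂ (<turn A i suc-k<turn)

    -- If the vertex is the far end of the edge starting at `j`, then going `k + 1` indices further
    -- completes a turn and returns to that edge's start.
    neighbours : ∀ {E} (A : Lift E) i {x} → E ∋[ π (pt A i) , x ] →
      x ≡ π (pt A (k + i)) ⊎ x ≡ π (pt A (suc k + i))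
    neighbours A i (inj₁ e) with cover A e
    ... | j , eq , x≡ = inj₁ (trans x≡ (π-index A (sym eq) k))
    neighbours A i (inj₂ e) with cover A e
    ... | j , x≡ , eq = inj₂ (trans x≡ (sym (trans (π-index A eq (suc k)) (trans (cong π (half-turns A j)) (π-turn (pt A j))))))

    endpoint : ∀ {E} (A : Lift E) {x y} → E ∋[ x , y ] → ∃[ i ] x ≡ π (pt A i)
    endpoint A (inj₁ e) with cover A e
    ... | i , x≡ , _ = i , x≡
    endpoint A (inj₂ e) with cover A e
    ... | i , _ , x≡ = k + i , x≡

    Bisects⇒IsBisector : ∀ {E} (A : Lift E) {i t} → Bisects A i t → IsBisector E (π (pt A i)) (π t)
    Bisects⇒IsBisector {E} A {i} {t} bis@(h₁ , h₂) =
      -- `Angle` lists its ends counterclockwise around the apex, so the later neighbour comes first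
      -- and the bisectors end on the arc from index `k + i` to `suc k + i`.
      π (pt A (suc k + i)) , π (pt A i) , π (pt A (k + i)) ,
      (swap (chord A (inj₂ refl) i) , chord A (inj₁ refl) i ,
        Cyc-rotate (Cyc-rotate (π-Cyc (mono-< A (m<n+m i 1≤k)) (step A (k + i)) (<turn A i suc-k<turn))) ,
        empty) ,
      inj₁ (refl , opening)
      where
      opening : Cyc (π (pt A (k + i))) (π t) (π (pt A (suc k + i)))
      opening = π-Cyc h₁ h₂ (<-≤-trans (<turn A i suc-k<turn) (+-monoʳ-≤ n (mono-≤ A (m≤n+m i k))))
      empty : ∀ x → Cyc (π (pt A (k + i))) x (π (pt A (suc k + i))) → ¬ (E ∋[ π (pt A i) , x ])
      empty x cyc e with neighbours A i e
      ... | inj₁ refl = Cyc-irrefl (Cyc-rotate (Cyc-rotate cyc))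
      ... | inj₂ refl = Cyc-irrefl cyc

    -- By `neighbours` each leg ends at index `k + i` or `suc k + i`, and `Cyc u v w` leaves a
    -- single assignment. Lifting `y` to the turn that starts at the first of these points turns
    -- cyclic order into order.
    angle⇒Bisects : ∀ {E} (A : Lift E) {u v w y} → Angle E u v w → Cyc w y u →
      ∃[ i ] ∃[ t ] (Bisects A i t × v ≡ π (pt A i) × y ≡ π t)
    angle⇒Bisects {E} A {u} {v} {w} {y} (uv , vw , cyc , _) cyc' with endpoint A vw
    ... | i , refl with neighbours A i (swap uv) | neighbours A i vw
    ...   | inj₁ refl | inj₁ refl = ⊥-elim (Cyc-irrefl (Cyc-rotate cyc))
    ...   | inj₂ refl | inj₂ refl = ⊥-elim (Cyc-irrefl (Cyc-rotate cyc))
    ...   | inj₁ refl | inj₂ refl = ⊥-elim (Cyc-asym (π-Cyc (mono-< A (m<n+m i 1≤k)) (step A (k + i)) (<turn A i suc-k<turn)) (Cyc-rotate cyc))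
    ...   | inj₂ refl | inj₁ refl with lift-point (pt A (k + i)) y
    ...     | t , lo , hi , refl = i , t , (lo' , π-Cyc⇒< lo' hi (step A (k + i))
                  (<-≤-trans (<turn A i suc-k<turn) (+-monoʳ-≤ n (mono-≤ A (m≤n+m i k)))) cyc') , refl , refl
      where
      lo' : pt A (k + i) < t
      lo' = ≤∧≢⇒< lo λ { refl → Cyc-irrefl (Cyc-rotate (Cyc-rotate cyc')) }

    IsBisector⇒Bisects : ∀ {E} (A : Lift E) {x y} → IsBisector E x y →
      ∃[ i ] ∃[ t ] (Bisects A i t × ((x ≡ π (pt A i) × y ≡ π t) ⊎ (y ≡ π (pt A i) × x ≡ π t)))
    IsBisector⇒Bisects A (u , v , w , ang , inj₁ (refl , cyc)) with angle⇒Bisects A ang cyc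
    ... | i , t , bis , p , q = i , t , bis , inj₁ (p , q)
    IsBisector⇒Bisects A (u , v , w , ang , inj₂ (refl , cyc)) with angle⇒Bisects A ang cyc
    ... | i , t , bis , p , q = i , t , bis , inj₂ (p , q)

    -- The bisector lies inside both angles at the common apex, so these overlap. Hence in distinct
    -- stars a common bisector has its apexes at opposite ends.
    same-apex⇒SameEdgeSet : ∀ {E F} (A : Lift E) (B : Lift F) → CrossingFree (suc k) (E ∪ F) →
      ∀ {i t j t'} → Bisects A i t → Bisects B j t' → π (pt A i) ≡ π (pt B j) → π t ≡ π t' → SameEdgeSet E F
    same-apex⇒SameEdgeSet A B cf {i} {t} {j} {t'} bis bis' apex≡ t≡ with π-≡⇒ apex≡
    ... | q , q' , eq = shared-angle⇒SameEdgeSet A B cf same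
          (<-trans (proj₁ bis₁) (subst (_< pt B (suc k + (q' * 2k+1 + j))) (sym t₁≡) (proj₂ bis₁')))
          (<-trans (proj₁ bis₁') (subst (_< pt A (suc k + (q * 2k+1 + i))) t₁≡ (proj₂ bis₁)))
      where
      same : pt A (q * 2k+1 + i) ≡ pt B (q' * 2k+1 + j)
      same = trans (periods A q i) (trans eq (sym (periods B q' j)))
      bis₁ : Bisects A (q * 2k+1 + i) (q * n + t)
      bis₁ = Bisects-periods A q bis
      bis₁' : Bisects B (q' * 2k+1 + j) (q' * n + t')
      bis₁' = Bisects-periods B q' bis'
      t₁≡ : q * n + t ≡ q' * n + t'
      -- Both lifts of the other end lie in the turn that starts at the common apex.
      t₁≡ = π-injective-within-turn (<⇒≤ (Bisects-above A bis₁)) (Bisects-below A bis₁)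
        (subst (_≤ q' * n + t') (sym same) (<⇒≤ (Bisects-above B bis₁')))
        (subst (λ z → q' * n + t' < n + z) (sym same) (Bisects-below B bis₁'))
        (trans (π-+ q t) (trans t≡ (sym (π-+ q' t'))))

    opposite-apexes⇒Opposite : ∀ {E F} (A : Lift E) (B : Lift F) → ∀ {i t j t'} →
      Bisects A i t → Bisects B j t' → π (pt A i) ≡ π t' → π t ≡ π (pt B j) →
      ∃[ i' ] ∃[ j' ] (Opposite A B i' j' × π (pt A i') ≡ π (pt A i) × π (pt B (suc k + j')) ≡ π (pt B j))
    opposite-apexes⇒Opposite A B {i} {t} {j} {t'} bis bis' a≡t' t≡b with π-≡⇒ t≡b
    -- `Opposite` indexes the apex of `B` as `suc k + j'`, so `j' = k + j₁` places it one turn after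
    -- `j₁`; the index of `A` is advanced by one turn to match.
    ... | q , q' , eq = 2k+1 + i₁ , k + j₁ ,
          ( ( subst (pt B (k + j₁) <_) turned (proj₁ bis₁')
            , subst (_< pt B (suc k + j₁)) turned (proj₂ bis₁'))
          , ( subst₂ _<_ (sym (move k)) (sym (half-turns B j₁)) (+-monoʳ-< n (subst (pt A (k + i₁) <_) t₁≡ (proj₁ bis₁)))
            , subst₂ _<_ (sym (half-turns B j₁)) (sym (move (suc k))) (+-monoʳ-< n (subst (_< pt A (suc k + i₁)) t₁≡ (proj₂ bis₁)))))
        , trans (cong π (period A i₁)) (trans (π-turn _) (π-periods A q i))
        , trans (cong π (half-turns B j₁)) (trans (π-turn _) (π-periods B q' j))
      where
      i₁ = q * 2k+1 + i
      j₁ = q' * 2k+1 + j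
      bis₁ : Bisects A i₁ (q * n + t)
      bis₁ = Bisects-periods A q bis
      bis₁' : Bisects B j₁ (q' * n + t')
      bis₁' = Bisects-periods B q' bis'
      t₁≡ : q * n + t ≡ pt B j₁
      t₁≡ = trans eq (sym (periods B q' j))
      turned : q' * n + t' ≡ pt A (2k+1 + i₁)
      turned = trans (π-injective-within-turn (<⇒≤ (Bisects-above B bis₁')) (Bisects-below B bis₁')
          (<⇒≤ (subst (_< n + pt A i₁) t₁≡ (Bisects-below A bis₁)))
          (+-monoʳ-< n (subst (pt A i₁ <_) t₁≡ (Bisects-above A bis₁)))
          (trans (π-+ q' t') (trans (sym a≡t') (sym (trans (π-turn (pt A i₁)) (π-periods A q i))))))
        (sym (period A i₁))
      move : ∀ d → pt A (d + (2k+1 + i₁)) ≡ n + pt A (d + i₁)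
      move d = trans (cong (pt A) (+-exchange d 2k+1 i₁)) (period A (d + i₁))

    Opposite⇒common : ∀ {E F} (A : Lift E) (B : Lift F) {i j} → Opposite A B i j →
      IsBisector E (π (pt A i)) (π (pt B (suc k + j))) × IsBisector F (π (pt A i)) (π (pt B (suc k + j)))
    Opposite⇒common {F = F} A B {i} {j} ((h₁ , h₂) , (h₃ , h₄)) =
      Bisects⇒IsBisector A (h₃ , h₄) ,
      -- Seen from the apex `pt B (suc k + j)`, the other end is met one turn after `pt A i`.
      flip (subst (IsBisector F _) (π-turn (pt A i)) (Bisects⇒IsBisector B {t = n + pt A i}
        ( subst (_< n + pt A i) (sym (half-turns' B j)) (+-monoʳ-< n h₁)
        , subst (n + pt A i <_) (trans (sym (half-turns B (suc j))) (cong (λ z → pt B (suc k + z)) (+-suc k j))) (+-monoʳ-< n h₂))))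
      where
      flip : ∀ {x y} → IsBisector F x y → IsBisector F y x
      flip (u , v , w , ang , end) = u , v , w , ang , swap end

    opposite-apexes-unique : ∀ {E F} (A : Lift E) (B : Lift F) → CrossingFree (suc k) (E ∪ F) →
      ∀ {i j} → Opposite A B i j → ∀ {i' t j' t'} → Bisects A i' t → Bisects B j' t' →
      π (pt A i') ≡ π t' → π t ≡ π (pt B j') →
      π (pt A i') ≡ π (pt A i) × π t ≡ π (pt B (suc k + j))
    opposite-apexes-unique A B cf opp bis bis' a≡t' t≡b =
      let _ , _ , opp₁ , a≡ , b≡ = opposite-apexes⇒Opposite A B bis bis' a≡t' t≡b
          a₁≡ , b₁≡ = Opposite-unique A B cf opp opp₁
      in trans (sym a≡) a₁≡ , trans t≡b (trans (sym b≡) b₁≡)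

    common-bisector-unique : ∀ {E F} (A : Lift E) (B : Lift F) → CrossingFree (suc k) (E ∪ F) →
      ¬ SameEdgeSet E F → ∀ {i j} → Opposite A B i j → ∀ x y → IsBisector E x y → IsBisector F x y →
      SameEdge x y (π (pt A i)) (π (pt B (suc k + j)))
    common-bisector-unique A B cf E≢F {i} {j} opp x y bE bF =
      cases (IsBisector⇒Bisects A bE) (IsBisector⇒Bisects B bF)
      where
      cases : ∃[ i' ] ∃[ t ] (Bisects A i' t × ((x ≡ π (pt A i') × y ≡ π t) ⊎ (y ≡ π (pt A i') × x ≡ π t))) →
        ∃[ j' ] ∃[ t' ] (Bisects B j' t' × ((x ≡ π (pt B j') × y ≡ π t') ⊎ (y ≡ π (pt B j') × x ≡ π t'))) →
        SameEdge x y (π (pt A i)) (π (pt B (suc k + j)))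
      cases (_ , _ , bis , inj₁ (p , q)) (_ , _ , bis' , inj₁ (p' , q')) =
        ⊥-elim (E≢F (same-apex⇒SameEdgeSet A B cf bis bis' (trans (sym p) p') (trans (sym q) q')))
      cases (_ , _ , bis , inj₂ (p , q)) (_ , _ , bis' , inj₂ (p' , q')) =
        ⊥-elim (E≢F (same-apex⇒SameEdgeSet A B cf bis bis' (trans (sym p) p') (trans (sym q) q')))
      cases (_ , _ , bis , inj₁ (p , q)) (_ , _ , bis' , inj₂ (p' , q')) =
        let r , s = opposite-apexes-unique A B cf opp bis bis' (trans (sym p) q') (trans (sym q) p')
        in inj₁ (trans p r , trans q s)
      cases (_ , _ , bis , inj₂ (p , q)) (_ , _ , bis' , inj₁ (p' , q')) =
        let r , s = opposite-apexes-unique A B cf opp bis bis' (trans (sym p) q') (trans (sym q) p')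
        in inj₂ (trans q s , trans p r)

    unique-common-bisector : ∀ {E F} (A : Lift E) (B : Lift F) → CrossingFree (suc k) (E ∪ F) →
      ¬ SameEdgeSet E F → (∀ i → pt B 0 < pt A i) →
      Σ (Fin n) λ x → Σ (Fin n) λ y → (IsBisector E x y × IsBisector F x y) ×
        ((x' y' : Fin n) → IsBisector E x' y' → IsBisector F x' y' → SameEdge x' y' x y)
    unique-common-bisector A B cf E≢F b₀<a = from-opposite (opposite A B cf E≢F b₀<a)
      where
      from-opposite : ∃[ i ] ∃[ j ] Opposite A B i j → _
      from-opposite (_ , _ , opp) = _ , _ , Opposite⇒common A B opp , common-bisector-unique A B cf E≢F opp

    -- Unrolling a given star.

    module StarLift (s : Fin 2k+1 → Fin n) (star : IsStarSeq k s) where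

      s₀ : ℕ
      s₀ = toℕ (s fzero)

      -- All vertices are placed in the turn that starts at `s₀`, where cyclic order seen from
      -- `s fzero` becomes order of naturals.
      unroll : Fin 2k+1 → ℕ
      unroll j with s₀ ≤? toℕ (s j)
      ... | yes _ = toℕ (s j)
      ... | no  _ = n + toℕ (s j)

      unroll-first : unroll fzero ≡ s₀
      unroll-first with s₀ ≤? s₀
      ... | yes _ = refl
      ... | no  ≰ = ⊥-elim (≰ ≤-refl)

      π-unroll : ∀ j → π (unroll j) ≡ s j
      π-unroll j with s₀ ≤? toℕ (s j)
      ... | yes _ = π-toℕ (s j)
      ... | no  _ = trans (π-turn _) (π-toℕ (s j))

      unroll-last : ∀ j → unroll j < n + s₀
      unroll-last j with s₀ ≤? toℕ (s j)
      ... | yes _ = <-≤-trans (toℕ<n (s j)) (m≤m+n n s₀)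
      ... | no  ≰ = +-monoʳ-< n (≰⇒> ≰)

      unroll-Cyc : ∀ {i j} → Cyc (s fzero) (s i) (s j) → unroll i < unroll j
      unroll-Cyc {i} {j} cyc with s₀ ≤? toℕ (s i) | s₀ ≤? toℕ (s j)
      unroll-Cyc (inj₁ (_ , lt))        | yes _ | yes _ = lt
      unroll-Cyc (inj₂ (inj₁ (_ , lt))) | yes _ | yes p = ⊥-elim (<⇒≱ lt p)
      unroll-Cyc (inj₂ (inj₂ (lt , _))) | yes _ | yes p = ⊥-elim (<⇒≱ lt p)
      unroll-Cyc {i} _                  | yes _ | no _  = <-≤-trans (toℕ<n (s i)) (m≤m+n n _)
      unroll-Cyc (inj₁ (lt , _))        | no ≰  | _     = ⊥-elim (≰ (<⇒≤ lt))
      unroll-Cyc (inj₂ (inj₂ (_ , lt))) | no ≰  | _     = ⊥-elim (≰ (<⇒≤ lt))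
      unroll-Cyc (inj₂ (inj₁ (_ , lt))) | no _  | yes p = ⊥-elim (<⇒≱ lt p)
      unroll-Cyc (inj₂ (inj₁ (lt , _))) | no _  | no _  = +-monoʳ-< n lt

      unroll-next : ∀ i j → toℕ j ≡ suc (toℕ i) → unroll i < unroll j
      unroll-next (fsuc i) j eq = unroll-Cyc (star fzero (fsuc i) j (s≤s z≤n) (subst (toℕ (fsuc i) <_) (sym eq) (n<1+n _)))
      -- `unroll-Cyc` compares only vertices following `s fzero` in cyclic order. Here it suffices
      -- that `s j` differs from `s fzero`, which the cyclic order with a third vertex, at index 2,
      -- guarantees.
      unroll-next fzero j eq = subst (_< unroll j) (sym unroll-first) first<
        where
        2<2k+1 : 2 < 2k+1
        2<2k+1 = s≤s (+-mono-≤ 1≤k 1≤k)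
        cyc : Cyc (s fzero) (s j) (s (fromℕ< 2<2k+1))
        cyc = star fzero j _ (subst (0 <_) (sym eq) (s≤s z≤n)) (subst₂ _<_ (sym eq) (sym (toℕ-fromℕ< 2<2k+1)) (n<1+n 1))
        first< : s₀ < unroll j
        first< with s₀ ≤? toℕ (s j)
        ... | no  _ = <-≤-trans (toℕ<n (s fzero)) (m≤m+n n _)
        ... | yes p = ≤∧≢⇒< p λ e → Cyc-irrefl (Cyc-rotate (Cyc-rotate (subst (λ z → Cyc z (s j) (s (fromℕ< 2<2k+1))) (toℕ-injective e) cyc)))

      point : ℕ → ℕ
      point i = i / 2k+1 * n + unroll (i mod 2k+1)

      point-at : ∀ q (r : Fin 2k+1) → point (q * 2k+1 + toℕ r) ≡ q * n + unroll r
      point-at q r = cong₂ (λ x y → x * n + unroll y) quot rem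
        where
        open ≡-Reasoning
        quot : (q * 2k+1 + toℕ r) / 2k+1 ≡ q
        quot = begin
          (q * 2k+1 + toℕ r) / 2k+1        ≡⟨ +-distrib-/-∣ˡ (toℕ r) (divides-refl q) ⟩
          q * 2k+1 / 2k+1 + toℕ r / 2k+1   ≡⟨ cong₂ _+_ (m*n/n≡m q 2k+1) (m<n⇒m/n≡0 (toℕ<n r)) ⟩
          q + 0                            ≡⟨ +-identityʳ q ⟩
          q                                ∎
        rem : (q * 2k+1 + toℕ r) mod 2k+1 ≡ r
        rem = toℕ-injective (begin
          toℕ ((q * 2k+1 + toℕ r) mod 2k+1)   ≡⟨ toℕ-fromℕ< (m%n<n (q * 2k+1 + toℕ r) 2k+1) ⟩
          (q * 2k+1 + toℕ r) % 2k+1           ≡⟨ cong (_% 2k+1) (+-comm (q * 2k+1) (toℕ r)) ⟩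
          (toℕ r + q * 2k+1) % 2k+1           ≡⟨ [m+kn]%n≡m%n (toℕ r) q 2k+1 ⟩
          toℕ r % 2k+1                        ≡⟨ m<n⇒m%n≡m (toℕ<n r) ⟩
          toℕ r                               ∎)

      split : ∀ i → i ≡ i / 2k+1 * 2k+1 + toℕ (i mod 2k+1)
      split i = trans (m≡m%n+[m/n]*n i 2k+1) (trans (+-comm (i % 2k+1) _)
        (cong (i / 2k+1 * 2k+1 +_) (sym (toℕ-fromℕ< (m%n<n i 2k+1)))))

      point-step : ∀ i → point i < point (suc i)
      point-step i with m≤n⇒m<n∨m≡n (toℕ<n (i mod 2k+1))
      ... | inj₁ 1+r<2k+1 = subst (point i <_)
              (trans (sym (point-at (i / 2k+1) (fromℕ< 1+r<2k+1))) (cong point (trans (cong (i / 2k+1 * 2k+1 +_) (toℕ-fromℕ< 1+r<2k+1))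
                (trans (+-suc _ _) (cong suc (sym (split i)))))))
              (+-monoʳ-< (i / 2k+1 * n) (unroll-next (i mod 2k+1) (fromℕ< 1+r<2k+1) (toℕ-fromℕ< 1+r<2k+1)))
      -- After the last index of a period comes `s₀` one turn later, which exceeds every unrolled
      -- point of the current turn.
      ... | inj₂ 1+r≡2k+1 = begin-strict
              point i                                    <⟨ +-monoʳ-< (i / 2k+1 * n) (unroll-last (i mod 2k+1)) ⟩
              i / 2k+1 * n + (n + s₀)                    ≡⟨ regroup (i / 2k+1 * n) n s₀ ⟩
              suc (i / 2k+1) * n + s₀                    ≡⟨ cong (suc (i / 2k+1) * n +_) unroll-first ⟨
              suc (i / 2k+1) * n + unroll fzero          ≡⟨ point-at (suc (i / 2k+1)) fzero ⟨
              point (suc (i / 2k+1) * 2k+1 + 0)          ≡⟨ cong point next ⟩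
              point (suc i)                              ∎
        where
        open ≤-Reasoning
        regroup : ∀ x n s → x + (n + s) ≡ n + x + s
        regroup = solve-∀
        next : suc (i / 2k+1) * 2k+1 + 0 ≡ suc i
        next = trans (+-identityʳ _) (trans (cong (_+ i / 2k+1 * 2k+1) (sym 1+r≡2k+1))
          (cong suc (trans (+-comm (toℕ (i mod 2k+1)) _) (sym (split i)))))

      point-period : ∀ i → point (2k+1 + i) ≡ n + point i
      point-period i = trans (cong point (trans (cong (2k+1 +_) (split i)) (sym (+-assoc 2k+1 (i / 2k+1 * 2k+1) _))))
        (trans (point-at (suc (i / 2k+1)) (i mod 2k+1)) (+-assoc n _ _))

      π-point : ∀ i → π (point i) ≡ s (i mod 2k+1)
      π-point i = trans (π-+ (i / 2k+1) _) (π-unroll (i mod 2k+1))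

      shiftₖ-mod : ∀ i → shiftₖ k (i mod 2k+1) ≡ (k + i) mod 2k+1
      shiftₖ-mod i = toℕ-injective (begin
        toℕ (shiftₖ k (i mod 2k+1))                   ≡⟨ toℕ-fromℕ< (m%n<n (toℕ (i mod 2k+1) + k) 2k+1) ⟩
        (toℕ (i mod 2k+1) + k) % 2k+1                 ≡⟨ [m+kn]%n≡m%n (toℕ (i mod 2k+1) + k) (i / 2k+1) 2k+1 ⟨
        (toℕ (i mod 2k+1) + k + i / 2k+1 * 2k+1) % 2k+1 ≡⟨ cong (_% 2k+1) (trans (regroup (toℕ (i mod 2k+1)) k (i / 2k+1 * 2k+1)) (cong (k +_) (sym (split i)))) ⟩
        (k + i) % 2k+1                                ≡⟨ toℕ-fromℕ< (m%n<n (k + i) 2k+1) ⟨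
        toℕ ((k + i) mod 2k+1)                        ∎)
        where
        open ≡-Reasoning
        regroup : ∀ r k x → r + k + x ≡ k + (x + r)
        regroup = solve-∀

      toℕ-mod : ∀ (j : Fin 2k+1) → toℕ j mod 2k+1 ≡ j
      toℕ-mod j = toℕ-injective (trans (toℕ-fromℕ< (m%n<n (toℕ j) 2k+1)) (m<n⇒m%n≡m (toℕ<n j)))

      starLift : Lift (Star k s)
      starLift .pt     = point
      starLift .step   = point-step
      starLift .period = point-period
      starLift .edge i = i mod 2k+1 , π-point i , trans (π-point (k + i)) (cong s (sym (shiftₖ-mod i)))
      starLift .cover (j , refl , refl) = toℕ j
        , sym (trans (π-point (toℕ j)) (cong s (toℕ-mod j)))
        , sym (trans (π-point (k + toℕ j)) (cong s (trans (sym (shiftₖ-mod (toℕ j))) (cong (shiftₖ k) (toℕ-mod j)))))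

theorem3p5 : (n k : ℕ) → 1 ≤ k → suc (k + k) ≤ n →
    (s s' : Fin (suc (k + k)) → Fin n) →
    IsStarSeq k s → IsStarSeq k s' →
    ¬ SameEdgeSet (Star k s) (Star k s') →
    CrossingFree (suc k) (Star k s ∪ Star k s') →
    Σ (Fin n) λ x → Σ (Fin n) λ y →
    (IsBisector (Star k s) x y × IsBisector (Star k s') x y) ×
    ((x' y' : Fin n) → IsBisector (Star k s) x' y' → IsBisector (Star k s') x' y' →
    SameEdge x' y' x y)
theorem3p5 (suc n) k 1≤k _ s s' star star' S≢S' cf =
  -- By `expanding`, shifting the index by `suc (pt B 0)` moves every point of `A` beyond `pt B 0`,
  -- so that each has a predecessor in `B`; the edge set stays the same.
  unique-common-bisector 1≤k (shift (suc (pt B 0)) A) B cf S≢S' λ i →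
    <-≤-trans (m≤n+m (suc (pt B 0)) i) (expanding A (i + suc (pt B 0)))
  where
  open Lifts (suc n) k
  open Lift
  A : Lift (Star k s)
  A = StarLift.starLift 1≤k s star
  B : Lift (Star k s')
  B = StarLift.starLift 1≤k s' star'
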